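{- Let $n\ge 2$ be an integer. For an integer $k$ with $2\le k\le n$, put $$\Lambda_1=\{(k_1+1,k_2,\ldots,k_{n-k+1}) : (k_1,k_2,\ldots,k_{n-k+1})\in\Lambda^{k-1}_{n-1}\},$$ and, when $2\le k\le [n/2]$, put $$\Lambda_2=\{(0,k_1,k_2,\ldots,k_{n-2k+1},\underbrace{0,0,\ldots,0}_{k-1\ \text{times}}) : (k_1,k_2,\ldots,k_{n-2k+1})\in\Lambda^{k}_{n-k}\}.$$ If $2\le k\le [n/2]$, then $\Lambda^k_n=\Lambda_1\cup\Lambda_2$. If $[n/2]<k\le n$, then $\Lambda^k_n=\Lambda_1$.
   Context: $\mathbb{N}_0=\{0,1,2,\ldots\}$ and $[x]$ denotes the integer part of $x$. For integers $1\le k\le n$, the partition set is $$\Lambda^k_n=\Big\{(k_1,k_2,\ldots,k_{n-k+1}) : \sum_{j=1}^{n-k+1}k_j=k,\ \sum_{j=1}^{n-k+1}jk_j=n,\ k_j\in\mathbb{N}_0\Big\}\subset\mathbb{N}_0^{n-k+1}.$$ -}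

module Defs where

open import Data.Nat using (ℕ; suc; _+_; _*_; _∸_; _≤_; s≤s; _/_)
open import Data.Nat.Properties
open import Data.Nat.DivMod using (m/n*n≤m)
open import Data.Fin using (zero; toℕ)
open import Data.Vec using (Vec; _∷_; _++_; sum; tabulate; lookup; replicate; updateAt)
open import Data.Vec.Relation.Binary.Equality.Cast using (_≈[_]_)
open import Data.Product using (_×_; ∃-syntax)
open import Level using (0ℓ)
open import Relation.Unary using (Pred; _∈_)
open import Relation.Binary.PropositionalEquality

-- Λ k n is the partition set Λ^k_n.  It is only meant for 1 ≤ k ≤ n, where the
-- subtraction is not truncated.  Vectors are indexed from 0, so the entry
-- `lookup v j` is k_{j+1} and carries the weight suc (toℕ j).
Λ : (k n : ℕ) → Pred (Vec ℕ (1 + (n ∸ k))) 0ℓ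
Λ k n v = sum v ≡ k × sum (tabulate λ j → suc (toℕ j) * lookup v j) ≡ n

length₁ : ∀ k n → 2 ≤ k → 1 + ((n ∸ 1) ∸ (k ∸ 1)) ≡ 1 + (n ∸ k)
length₁ (suc k) n (s≤s _) = cong suc (∸-+-assoc n 1 k)

2*k≤n : ∀ k n → k ≤ n / 2 → k + k ≤ n
2*k≤n k n k≤n/2 = begin
  k + k          ≡⟨ cong (k +_) (+-identityʳ k) ⟨
  2 * k          ≡⟨ *-comm 2 k ⟩
  k * 2          ≤⟨ *-monoˡ-≤ 2 k≤n/2 ⟩
  (n / 2) * 2    ≤⟨ m/n*n≤m n 2 ⟩
  n              ∎
  where open ≤-Reasoning

length₂ : ∀ k n → 2 ≤ k → k ≤ n / 2 →
          1 + ((1 + ((n ∸ k) ∸ k)) + (k ∸ 1)) ≡ 1 + (n ∸ k)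
length₂ k@(suc k-1) n _ k≤n/2 = cong suc (begin
  suc (((n ∸ k) ∸ k) + k-1) ≡⟨ +-suc ((n ∸ k) ∸ k) k-1 ⟨
  ((n ∸ k) ∸ k) + k         ≡⟨ m∸n+n≡m (m+n≤o⇒m≤o∸n k (2*k≤n k n k≤n/2)) ⟩
  n ∸ k                     ∎)
  where open ≡-Reasoning

-- In Λ₁ and Λ₂ the vector built from w has the right length only up to a
-- propositional equality; xs ≈[ eq ] v says that xs, transported along eq, is v.
Λ₁ : (k n : ℕ) → 2 ≤ k → Pred (Vec ℕ (1 + (n ∸ k))) 0ℓ
Λ₁ k n 2≤k v =
  ∃[ w ] w ∈ Λ (k ∸ 1) (n ∸ 1) × updateAt w zero suc ≈[ length₁ k n 2≤k ] v

Λ₂ : (k n : ℕ) → 2 ≤ k → k ≤ n / 2 → Pred (Vec ℕ (1 + (n ∸ k))) 0ℓ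
Λ₂ k n 2≤k k≤n/2 v =
  ∃[ w ] w ∈ Λ k (n ∸ k) ×
         (0 ∷ (w ++ replicate (k ∸ 1) 0)) ≈[ length₂ k n 2≤k k≤n/2 ] v

{-# OPTIONS --safe #-}

-- The first entry of v ∈ Λ k n decides the case.  If it is suc x, lowering it by
-- one lowers both the number of parts and their total by one, which is Λ₁.  If it
-- is 0, shifting the remaining entries v′ down one place lowers each of the k
-- parts by one, so v′ has k parts with total n ∸ k ≥ k; this forces 2k ≤ n, and a
-- part of v′ exceeding 1 + (n ∸ 2k) would make the total too large, so the last
-- k ∸ 1 entries of v′ vanish, which is Λ₂.

module Submission where

open import Defs
open import Data.Nat using (ℕ; zero; suc; _+_; _*_; _∸_; _≤_; _<_; _/_; s≤s)
open import Data.Nat.Properties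
open import Data.Nat.DivMod using (m*n/n≡m; /-monoˡ-≤)
open import Data.Nat.Tactic.RingSolver using (solve-∀)
open import Data.Fin using (Fin; zero; suc; toℕ)
open import Data.Vec using (Vec; []; _∷_; _++_; sum; tabulate; lookup; replicate; cast; splitAt)
open import Data.Vec.Properties using (sum-++; tabulate∘lookup)
open import Data.Vec.Relation.Binary.Equality.Cast using (_≈[_]_; ≈-sym)
open import Data.Product using (_×_; _,_; map)
open import Data.Sum using (inj₁; inj₂; [_,_]′)
open import Function using (_∘_)
open import Level using (Level)
open import Relation.Nullary using (contradiction)
open import Relation.Unary using (_≐_; _∪_; _∈_)
open import Relation.Binary.PropositionalEquality

private
  variable
    a b : Level
    A : Set a
    B : Set b
    k l m n : ℕ

-- Carries `sum` and `weight` across a cast. `f` must accept every length, since the induction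
-- absorbs the heads into it one by one.
≈-elim : (f : ∀ {n} → Vec A n → B) {xs : Vec A m} {ys : Vec A n} .{eq : m ≡ n} →
         xs ≈[ eq ] ys → f xs ≡ f ys
≈-elim f {[]}     {[]}    refl = refl
≈-elim f {x ∷ xs} {_ ∷ _} refl = ≈-elim (f ∘ (x ∷_)) refl

sum-tabulate-+ : (f g : Fin n → ℕ) →
  sum (tabulate λ j → f j + g j) ≡ sum (tabulate f) + sum (tabulate g)
sum-tabulate-+ {zero}  f g = refl
sum-tabulate-+ {suc n} f g = begin
  f zero + g zero + sum (tabulate λ j → f (suc j) + g (suc j))
    ≡⟨ cong (f zero + g zero +_) (sum-tabulate-+ (f ∘ suc) (g ∘ suc)) ⟩
  f zero + g zero + (sum (tabulate (f ∘ suc)) + sum (tabulate (g ∘ suc)))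
    ≡⟨ interchange (f zero) (g zero) _ _ ⟩
  f zero + sum (tabulate (f ∘ suc)) + (g zero + sum (tabulate (g ∘ suc))) ∎
  where
  open ≡-Reasoning
  interchange : ∀ p q r s → p + q + (r + s) ≡ p + r + (q + s)
  interchange = solve-∀

sum-replicate-0 : ∀ n → sum (replicate n 0) ≡ 0
sum-replicate-0 zero    = refl
sum-replicate-0 (suc n) = sum-replicate-0 n

sum≡0⇒replicate : (v : Vec ℕ n) → sum v ≡ 0 → v ≡ replicate n 0
sum≡0⇒replicate []         _  = refl
sum≡0⇒replicate (zero ∷ v) eq = cong (0 ∷_) (sum≡0⇒replicate v eq)

-- The same expression as in `Λ`, so that membership in `Λ` unfolds to statements about `weight`.
weight : Vec ℕ n → ℕ
weight v = sum (tabulate λ j → suc (toℕ j) * lookup v j)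

-- Moving `v` one place to the right enlarges each of its `sum v` parts by one.
weight-∷ : ∀ x (v : Vec ℕ n) → weight (x ∷ v) ≡ x + (sum v + weight v)
weight-∷ x v = cong₂ _+_ (*-identityˡ x) (begin
  sum (tabulate λ j → lookup v j + suc (toℕ j) * lookup v j)
    ≡⟨ sum-tabulate-+ (lookup v) _ ⟩
  sum (tabulate (lookup v)) + weight v
    ≡⟨ cong (λ u → sum u + weight v) (tabulate∘lookup v) ⟩
  sum v + weight v ∎)
  where open ≡-Reasoning

sum≤weight : (v : Vec ℕ n) → sum v ≤ weight v
sum≤weight []      = ≤-refl
sum≤weight (x ∷ v) = begin
  x + sum v              ≤⟨ +-monoʳ-≤ x (m≤m+n (sum v) (weight v)) ⟩
  x + (sum v + weight v) ≡⟨ weight-∷ x v ⟨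
  weight (x ∷ v)         ∎
  where open ≤-Reasoning

-- Behind `u`, each of the `sum v` parts recorded by `v` is larger by `m`.
weight-++ : (u : Vec ℕ m) (v : Vec ℕ n) →
            weight (u ++ v) ≡ weight u + (m * sum v + weight v)
weight-++         []      v = refl
weight-++ {suc m} (x ∷ u) v = begin
  weight (x ∷ u ++ v)
    ≡⟨ weight-∷ x (u ++ v) ⟩
  x + (sum (u ++ v) + weight (u ++ v))
    ≡⟨ cong (x +_) (cong₂ _+_ (sum-++ u) (weight-++ u v)) ⟩
  x + (sum u + sum v + (weight u + (m * sum v + weight v)))
    ≡⟨ regroup x (sum u) (sum v) (weight u) (m * sum v) (weight v) ⟩
  x + (sum u + weight u) + (sum v + m * sum v + weight v)
    ≡⟨ cong (_+ (suc m * sum v + weight v)) (weight-∷ x u) ⟨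
  weight (x ∷ u) + (suc m * sum v + weight v) ∎
  where
  open ≡-Reasoning
  regroup : ∀ p q r s t w → p + (q + r + (s + (t + w))) ≡ p + (q + s) + (r + t + w)
  regroup = solve-∀

weight-replicate-0 : ∀ n → weight (replicate n 0) ≡ 0
weight-replicate-0 zero    = refl
weight-replicate-0 (suc n) = begin
  weight (0 ∷ replicate n 0)                   ≡⟨ weight-∷ 0 (replicate n 0) ⟩
  sum (replicate n 0) + weight (replicate n 0) ≡⟨ cong₂ _+_ (sum-replicate-0 n) (weight-replicate-0 n) ⟩
  0                                            ∎
  where open ≡-Reasoning

sum-++-replicate-0 : (u : Vec ℕ m) → sum (u ++ replicate n 0) ≡ sum u
sum-++-replicate-0 {n = n} u = begin
  sum (u ++ replicate n 0)    ≡⟨ sum-++ u ⟩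
  sum u + sum (replicate n 0) ≡⟨ cong (sum u +_) (sum-replicate-0 n) ⟩
  sum u + 0                   ≡⟨ +-identityʳ (sum u) ⟩
  sum u                       ∎
  where open ≡-Reasoning

weight-++-replicate-0 : (u : Vec ℕ m) → weight (u ++ replicate n 0) ≡ weight u
weight-++-replicate-0 {m} {n} u = begin
  weight (u ++ replicate n 0)
    ≡⟨ weight-++ u (replicate n 0) ⟩
  weight u + (m * sum (replicate n 0) + weight (replicate n 0))
    ≡⟨ cong (weight u +_) (cong₂ (λ s w → m * s + w) (sum-replicate-0 n) (weight-replicate-0 n)) ⟩
  weight u + (m * 0 + 0)
    ≡⟨ cong (λ z → weight u + (z + 0)) (*-zeroʳ m) ⟩
  weight u + 0
    ≡⟨ +-identityʳ (weight u) ⟩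
  weight u ∎
  where open ≡-Reasoning

-- Every part contributes at least one to the weight, and a part recorded in `v` contributes at
-- least `m` more. A single such part would already push the weight up to `sum (u ++ v) + m`.
weight<sum+length⇒tail≡0 : (u : Vec ℕ m) (v : Vec ℕ n) →
  weight (u ++ v) < sum (u ++ v) + m → v ≡ replicate n 0
weight<sum+length⇒tail≡0 {m} u v lt with sum v in eq
... | zero  = sum≡0⇒replicate v eq
... | suc s = contradiction lt (≤⇒≯ (begin
  sum (u ++ v) + m                   ≡⟨ cong (_+ m) (sum-++ u) ⟩
  sum u + sum v + m                  ≡⟨ +-assoc (sum u) (sum v) m ⟩
  sum u + (sum v + m)                ≤⟨ +-mono-≤ (sum≤weight u) (+-mono-≤ (sum≤weight v) (m≤m*n m (suc s))) ⟩
  weight u + (weight v + m * suc s)  ≡⟨ cong (λ t → weight u + (weight v + m * t)) eq ⟨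
  weight u + (weight v + m * sum v)  ≡⟨ cong (weight u +_) (+-comm (weight v) (m * sum v)) ⟩
  weight u + (m * sum v + weight v)  ≡⟨ weight-++ u v ⟨
  weight (u ++ v)                    ∎))
  where open ≤-Reasoning

-- Membership in Λ k n without the constraint on the length of the vector.
Partition : (k n : ℕ) → Vec ℕ m → Set
Partition k n v = sum v ≡ k × weight v ≡ n

partition-≈ : {v : Vec ℕ l} {w : Vec ℕ m} .{eq : l ≡ m} →
              v ≈[ eq ] w → Partition k n v → Partition k n w
partition-≈ v≈w = map (trans (sym (≈-elim sum v≈w))) (trans (sym (≈-elim weight v≈w)))

partition-0∷⁺ : (v : Vec ℕ m) → k ≤ n → Partition k (n ∸ k) v → Partition k n (0 ∷ v)
partition-0∷⁺ {k = k} {n} v k≤n (sum≡ , weight≡) = sum≡ , (begin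
  weight (0 ∷ v)   ≡⟨ weight-∷ 0 v ⟩
  sum v + weight v ≡⟨ cong₂ _+_ sum≡ weight≡ ⟩
  k + (n ∸ k)      ≡⟨ m+[n∸m]≡n k≤n ⟩
  n                ∎)
  where open ≡-Reasoning

-- Dropping the leading 0 takes one off each of the `k` parts; `n` equals `k + weight v`, so the
-- subtraction is exact.
partition-0∷⁻ : (v : Vec ℕ m) → Partition k n (0 ∷ v) → Partition k (n ∸ k) v
partition-0∷⁻ {k = k} {n} v (sum≡ , weight≡) = sum≡ , (begin
  weight v               ≡⟨ m+n∸m≡n k (weight v) ⟨
  k + weight v ∸ k       ≡⟨ cong (λ s → s + weight v ∸ k) sum≡ ⟨
  sum v + weight v ∸ k   ≡⟨ cong (_∸ k) (weight-∷ 0 v) ⟨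
  weight (0 ∷ v) ∸ k     ≡⟨ cong (_∸ k) weight≡ ⟩
  n ∸ k                  ∎)
  where open ≡-Reasoning

-- With no part of size one, each of the `k` parts has size at least two.
partition-0∷⇒k+k≤n : (v : Vec ℕ m) → Partition k n (0 ∷ v) → k + k ≤ n
partition-0∷⇒k+k≤n {k = k} {n} v (sum≡ , weight≡) = begin
  k + k            ≡⟨ cong₂ _+_ sum≡ sum≡ ⟨
  sum v + sum v    ≤⟨ +-monoʳ-≤ (sum v) (sum≤weight v) ⟩
  sum v + weight v ≡⟨ weight-∷ 0 v ⟨
  weight (0 ∷ v)   ≡⟨ weight≡ ⟩
  n                ∎
  where open ≤-Reasoning

-- The largest possible part has size `1 + (n ∸ k)`, reached when all others are 1, and `u` has
-- exactly that length.
partition-tail≡0 : (u : Vec ℕ (1 + (n ∸ k))) (v : Vec ℕ m) → k ≤ n →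
                   Partition k n (u ++ v) → v ≡ replicate m 0
partition-tail≡0 {n} {k} u v k≤n (sum≡ , weight≡) = weight<sum+length⇒tail≡0 u v (begin-strict
  weight (u ++ v)               ≡⟨ weight≡ ⟩
  n                             ≡⟨ m+[n∸m]≡n k≤n ⟨
  k + (n ∸ k)                   <⟨ +-monoʳ-< k (n<1+n (n ∸ k)) ⟩
  k + (1 + (n ∸ k))             ≡⟨ cong (_+ (1 + (n ∸ k))) sum≡ ⟨
  sum (u ++ v) + (1 + (n ∸ k))  ∎)
  where open ≤-Reasoning

k+k≤n⇒k≤n/2 : k + k ≤ n → k ≤ n / 2
k+k≤n⇒k≤n/2 {k} {n} k+k≤n = begin
  k           ≡⟨ m*n/n≡m k 2 ⟨
  k * 2 / 2   ≤⟨ /-monoˡ-≤ 2 (≤-trans (≤-reflexive k*2≡k+k) k+k≤n) ⟩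
  n / 2       ∎
  where
  open ≤-Reasoning
  k*2≡k+k : k * 2 ≡ k + k
  k*2≡k+k = trans (*-comm k 2) (cong (k +_) (+-identityʳ k))

Λ₁⊆Λ : ∀ k n (2≤k : 2 ≤ k) → k ≤ n → ∀ {v} → v ∈ Λ₁ k n 2≤k → v ∈ Λ k n
Λ₁⊆Λ (suc k) (suc n) 2≤k@(s≤s _) _ (x ∷ w , w∈Λ , w≈v) =
  -- The first place has weight 1, so raising its entry turns both `sum` and `weight` into their
  -- successors by computation.
  partition-≈ {v = suc x ∷ w} {eq = length₁ (suc k) (suc n) 2≤k} w≈v (map (cong suc) (cong suc) w∈Λ)

Λ-suc∷⇒Λ₁ : ∀ k n (2≤k : 2 ≤ k) → k ≤ n → ∀ x v →
            (suc x ∷ v) ∈ Λ k n → (suc x ∷ v) ∈ Λ₁ k n 2≤k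
Λ-suc∷⇒Λ₁ (suc k) (suc n) 2≤k@(s≤s _) _ x v v∈Λ =
  x ∷ cast (sym eq) v ,
  partition-≈ {eq = cong suc (sym eq)} refl (map suc-injective suc-injective v∈Λ) ,
  cong (suc x ∷_) (≈-sym {m≡n = sym eq} refl)
  where eq = suc-injective (length₁ (suc k) (suc n) 2≤k)

Λ₂⊆Λ : ∀ k n (2≤k : 2 ≤ k) → k ≤ n → (k≤n/2 : k ≤ n / 2) →
       ∀ {v} → v ∈ Λ₂ k n 2≤k k≤n/2 → v ∈ Λ k n
Λ₂⊆Λ k n 2≤k k≤n k≤n/2 (w , (sum≡ , weight≡) , w≈v) =
  partition-≈ {v = 0 ∷ w₀} {eq = length₂ k n 2≤k k≤n/2} w≈v (partition-0∷⁺ w₀ k≤n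
    (trans (sum-++-replicate-0 w) sum≡ , trans (weight-++-replicate-0 w) weight≡))
  where w₀ = w ++ replicate (k ∸ 1) 0

Λ-0∷⇒Λ₂ : ∀ k n (2≤k : 2 ≤ k) (k≤n/2 : k ≤ n / 2) → ∀ v →
          (0 ∷ v) ∈ Λ k n → (0 ∷ v) ∈ Λ₂ k n 2≤k k≤n/2
Λ-0∷⇒Λ₂ k n 2≤k k≤n/2 v v∈Λ
  with eq ← suc-injective (length₂ k n 2≤k k≤n/2)
  -- The cut leaves `k ∸ 1` entries in `z`, the block of zeros in `Λ₂`.
  with u , z , v≈u++z ← splitAt (1 + (n ∸ k ∸ k)) (cast (sym eq) v)
  with u++z∈@(sum≡ , weight≡) ← partition-≈ v≈u++z (partition-0∷⁻ v v∈Λ)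
  -- The total is now `n ∸ k`, so the bound required is `k ≤ n ∸ k`, which follows from `k + k ≤ n`.
  with refl ← partition-tail≡0 u z (m+n≤o⇒m≤o∸n k (2*k≤n k n k≤n/2)) u++z∈
  = u ,
    (trans (sym (sum-++-replicate-0 u)) sum≡ , trans (sym (weight-++-replicate-0 u)) weight≡) ,
    cong (0 ∷_) (≈-sym v≈u++z)

theorem2p2 : (n : ℕ) → 2 ≤ n → (k : ℕ) → (2≤k : 2 ≤ k) → k ≤ n →
    ((k≤n/2 : k ≤ n / 2) → Λ k n ≐ (Λ₁ k n 2≤k ∪ Λ₂ k n 2≤k k≤n/2)) ×
    (n / 2 < k → Λ k n ≐ Λ₁ k n 2≤k)
theorem2p2 n 2≤n k 2≤k k≤n =
  (λ k≤n/2 →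
    (λ { {zero ∷ v}  v∈Λ → inj₂ (Λ-0∷⇒Λ₂ k n 2≤k k≤n/2 v v∈Λ)
       ; {suc x ∷ v} v∈Λ → inj₁ (Λ-suc∷⇒Λ₁ k n 2≤k k≤n x v v∈Λ) }) ,
    [ Λ₁⊆Λ k n 2≤k k≤n , Λ₂⊆Λ k n 2≤k k≤n k≤n/2 ]′) ,
  (λ n/2<k →
    -- A zero first entry would force `k + k ≤ n`, hence `k ≤ n / 2`.
    (λ { {zero ∷ v}  v∈Λ → contradiction (k+k≤n⇒k≤n/2 (partition-0∷⇒k+k≤n v v∈Λ)) (<⇒≱ n/2<k)
       ; {suc x ∷ v} v∈Λ → Λ-suc∷⇒Λ₁ k n 2≤k k≤n x v v∈Λ }) ,
    Λ₁⊆Λ k n 2≤k k≤n)
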